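{- The safe zone satisfies $$\mathcal{D}=\{g\in\mathrm{SO}(3): Q(g)\ge 0\}\cap\{g\in\mathrm{SO}(3): U_1^2(g)\ge 4\}.$$
   Context: $\mathrm{SO}(3)$ is the group of rotations of $\mathbb{R}^3$ about the origin. Let $u_0=(0,0,1)$, $v_0=(1,0,0)$, $a_1=2u_0=(0,0,2)$, and let $\ell_0=\{2u_0+tv_0:t\in\mathbb{R}\}$. For $g\in\mathrm{SO}(3)$ the line $g\cdot\ell_0$ is the image $\{2gu_0+t\,gv_0:t\in\mathbb{R}\}$. The safe zone is $\mathcal{D}=\{g\in\mathrm{SO}(3):\mathrm{dist}(\ell_0,g\cdot\ell_0)\ge 2\}$, where $\mathrm{dist}$ is the Euclidean distance (infimum) between the two lines. For $g\in\mathrm{SO}(3)$ put $d_1=v_0$, $d_2=gv_0$, $a_2=2gu_0$, $w=a_2-a_1$, $n=d_1\times d_2$, $N_2=|n|^2$, and define $$\Gamma(w)=(w\cdot d_1)^2-2(w\cdot d_1)(w\cdot d_2)(d_1\cdot d_2)+(w\cdot d_2)^2,$$ $$U_1^2=U_1^2(g)=|w|^2-(w\cdot d_1)^2,\qquad Q=Q(g)=(|w|^2-4)N_2-\Gamma(w).$$ ($U_1\ge 0$ is the distance from the point $a_2$ to the line $\ell_0$.) -}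

module Defs where

open import Level using (0ℓ)
open import Algebra.Bundles using (CommutativeRing)
import Algebra.Properties.Ring as RingProperties
import Algebra.Solver.Ring.NaturalCoefficients.Default as NatSolver
open import Data.Bool.Base using (if_then_else_)
open import Data.Fin.Base using (Fin)
open import Data.Fin.Patterns using (0F; 1F; 2F)
open import Data.Fin.Properties using (_≟_)
open import Data.Product.Base using (∃; _×_; _,_; proj₁; proj₂)
open import Data.Sum.Base using (inj₁; inj₂)
open import Data.Vec.Functional using (Vector; []; _∷_; map; zipWith)
open import Data.Vec.Functional.Relation.Binary.Pointwise using (Pointwise)
open import Function.Base using (_∘_)
open import Relation.Binary.Core using (Rel)
open import Relation.Binary.Structures using (IsDecTotalOrder)
open import Relation.Nullary using (¬_; yes; no; contradiction)
open import Relation.Nullary.Decidable using (⌊_⌋)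
open import Relation.Unary using (Pred; _∈_; Satisfiable)

-- The standard library has no real numbers.  They are given by their
-- usual axioms, as a Dedekind-complete ordered field; classically this
-- determines them up to isomorphism.  Equality is a setoid equality, and
-- the (classically automatic) decidability of the order is an axiom.

record CompleteOrderedField : Set₁ where
  infix 4 _≤_
  field
    commutativeRing : CommutativeRing 0ℓ 0ℓ

  open CommutativeRing commutativeRing public

  field
    _≤_             : Rel Carrier 0ℓ
    isDecTotalOrder : IsDecTotalOrder _≈_ _≤_
    1≉0             : ¬ 1# ≈ 0#
    inverse         : ∀ x → ¬ x ≈ 0# → ∃ λ y → x * y ≈ 1#
    +-monoˡ-≤       : ∀ z {x y} → x ≤ y → x + z ≤ y + z
    *-nonneg        : ∀ {x y} → 0# ≤ x → 0# ≤ y → 0# ≤ x * y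

  IsUpperBound : Pred Carrier 0ℓ → Pred Carrier 0ℓ
  IsUpperBound P b = ∀ x → x ∈ P → x ≤ b

  IsLowerBound : Pred Carrier 0ℓ → Pred Carrier 0ℓ
  IsLowerBound P b = ∀ x → x ∈ P → b ≤ x

  IsSupremum : Pred Carrier 0ℓ → Pred Carrier 0ℓ
  IsSupremum P s = IsUpperBound P s × (∀ b → IsUpperBound P b → s ≤ b)

  IsInfimum : Pred Carrier 0ℓ → Pred Carrier 0ℓ
  IsInfimum P m = IsLowerBound P m × (∀ b → IsLowerBound P b → b ≤ m)

  field
    supremum : ∀ P → Satisfiable P → Satisfiable (IsUpperBound P) →
               ∃ (IsSupremum P)

  module ≤ = IsDecTotalOrder isDecTotalOrder

module RealProperties (ℝ : CompleteOrderedField) where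

  open CompleteOrderedField ℝ
  open RingProperties ring using (-‿distribˡ-*; -‿distribʳ-*; -‿involutive)
  open NatSolver commutativeSemiring using (solve; _:=_; _:+_; _:*_)

  infimum : ∀ P → Satisfiable P → Satisfiable (IsLowerBound P) →
            ∃ (IsInfimum P)
  infimum P (x , x∈P) bounded
    with supremum (IsLowerBound P) bounded (x , λ b b≤P → b≤P x x∈P)
  ... | m , upper , least =
    m , (λ y y∈P → least y (λ b b≤P → b≤P y y∈P)) , upper

  ≤-respʳ : ∀ {x y z} → y ≈ z → x ≤ y → x ≤ z
  ≤-respʳ y≈z x≤y = ≤.trans x≤y (≤.reflexive y≈z)

  ≤-respˡ : ∀ {x y z} → x ≈ y → x ≤ z → y ≤ z
  ≤-respˡ x≈y x≤z = ≤.trans (≤.reflexive (sym x≈y)) x≤z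

  ≤⇒∃+ : ∀ {x y} → x ≤ y → ∃ λ d → 0# ≤ d × x + d ≈ y
  ≤⇒∃+ {x} {y} x≤y =
    y + - x , ≤-respˡ (-‿inverseʳ x) (+-monoˡ-≤ (- x) x≤y) ,
    trans (+-comm x _) (trans (+-assoc y (- x) x)
      (trans (+-congˡ (-‿inverseˡ x)) (+-identityʳ y)))

  ∃+⇒≤ : ∀ {x y} d → 0# ≤ d → x + d ≈ y → x ≤ y
  ∃+⇒≤ {x} d 0≤d x+d≈y =
    ≤-respˡ (+-identityˡ x)
      (≤-respʳ (trans (+-comm d x) x+d≈y) (+-monoˡ-≤ x 0≤d))

  +-nonneg : ∀ {x y} → 0# ≤ x → 0# ≤ y → 0# ≤ x + y
  +-nonneg {x} {y} 0≤x 0≤y =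
    ≤.trans 0≤y (≤-respˡ (+-identityˡ y) (+-monoˡ-≤ y 0≤x))

  +-cancelʳ-≤ : ∀ z {x y} → x + z ≤ y + z → x ≤ y
  +-cancelʳ-≤ z {x} {y} h =
    ≤-respˡ (undo x) (≤-respʳ (undo y) (+-monoˡ-≤ (- z) h))
    where
    undo : ∀ u → (u + z) + - z ≈ u
    undo u = trans (+-assoc u z (- z))
      (trans (+-congˡ (-‿inverseʳ z)) (+-identityʳ u))

  *-monoʳ-≤ : ∀ {z x y} → 0# ≤ z → x ≤ y → z * x ≤ z * y
  *-monoʳ-≤ {z} {x} 0≤z x≤y with ≤⇒∃+ x≤y
  ... | d , 0≤d , eq =
    ∃+⇒≤ (z * d) (*-nonneg 0≤z 0≤d) (trans (sym (distribˡ z x d)) (*-congˡ eq))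

  square-nonneg : ∀ x → 0# ≤ x * x
  square-nonneg x with ≤.total 0# x
  ... | inj₁ 0≤x = *-nonneg 0≤x 0≤x
  ... | inj₂ x≤0 = ≤-respʳ -x*-x≈x*x (*-nonneg 0≤-x 0≤-x)
    where
    0≤-x : 0# ≤ - x
    0≤-x = ≤-respˡ (-‿inverseʳ x)
             (≤-respʳ (+-identityˡ (- x)) (+-monoˡ-≤ (- x) x≤0))
    -x*-x≈x*x : - x * - x ≈ x * x
    -x*-x≈x*x = trans (sym (-‿distribˡ-* x (- x)))
      (trans (-‿cong (sym (-‿distribʳ-* x x))) (-‿involutive (x * x)))

  0≤1 : 0# ≤ 1#
  0≤1 = ≤-respʳ (*-identityˡ 1#) (square-nonneg 1#)

  inverse-nonneg : ∀ {x y} → 0# ≤ x → x * y ≈ 1# → 0# ≤ y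
  inverse-nonneg {x} {y} 0≤x xy≈1 =
    ≤-respʳ (trans (solve 2 (λ x y → x :* (y :* y) := (x :* y) :* y) refl x y)
              (trans (*-congʳ xy≈1) (*-identityˡ y)))
      (*-nonneg 0≤x (square-nonneg y))

  *-cancelˡ-≤ : ∀ {z x y} → 0# ≤ z → ¬ z ≈ 0# → z * x ≤ z * y → x ≤ y
  *-cancelˡ-≤ {z} {x} {y} 0≤z z≉0 h with inverse z z≉0
  ... | i , zi≈1 =
    ≤-respˡ (undo x) (≤-respʳ (undo y) (*-monoʳ-≤ (inverse-nonneg 0≤z zi≈1) h))
    where
    undo : ∀ u → i * (z * u) ≈ u
    undo u = trans
      (solve 3 (λ i z u → i :* (z :* u) := (z :* i) :* u) refl i z u)
      (trans (*-congʳ zi≈1) (*-identityˡ u))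

  square≤0⇒≈0 : ∀ {x} → x * x ≤ 0# → x ≈ 0#
  square≤0⇒≈0 {x} x²≤0 with x ≤.≟ 0#
  ... | yes x≈0 = x≈0
  ... | no  x≉0 with inverse x x≉0
  ...   | i , xi≈1 = contradiction
    (trans (sym (trans (*-cong xi≈1 xi≈1) (*-identityˡ 1#)))
      (trans (solve 2 (λ x i → (x :* i) :* (x :* i) := (x :* x) :* (i :* i)) refl x i)
        (trans (*-congʳ (≤.antisym x²≤0 (square-nonneg x))) (zeroˡ _))))
    1≉0

  x+x≈0⇒x≈0 : ∀ {x} → 0# ≤ x → x + x ≈ 0# → x ≈ 0#
  x+x≈0⇒x≈0 {x} 0≤x x+x≈0 = ≤.antisym (∃+⇒≤ x 0≤x x+x≈0) 0≤x

  square-cancel-≤ : ∀ {x y} → 0# ≤ y → x * x ≤ y * y → x ≤ y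
  square-cancel-≤ {x} {y} 0≤y x²≤y² with ≤.total x y
  ... | inj₁ x≤y = x≤y
  ... | inj₂ y≤x with ≤⇒∃+ y≤x
  ...   | d , 0≤d , y+d≈x = ≤.reflexive
    (trans (sym y+d≈x) (trans (+-congˡ (square≤0⇒≈0 d²≤0)) (+-identityʳ y)))
    where
    d²≤0 : d * d ≤ 0#
    d²≤0 = +-cancelʳ-≤ (y * y) (≤-respʳ (sym (+-identityˡ _))
      (≤.trans
        (∃+⇒≤ (y * d + y * d) (+-nonneg (*-nonneg 0≤y 0≤d) (*-nonneg 0≤y 0≤d))
          (trans
            (solve 2 (λ y d → (d :* d :+ y :* y) :+ (y :* d :+ y :* d)
                        := (y :+ d) :* (y :+ d)) refl y d)
            (*-cong y+d≈x y+d≈x)))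
        x²≤y²))

  4xy≤[x+y]² : ∀ x y → (x * y + x * y) + (x * y + x * y) ≤ (x + y) * (x + y)
  4xy≤[x+y]² x y with ≤.total x y
  ... | inj₁ x≤y with ≤⇒∃+ x≤y
  ...   | d , _ , x+d≈y = ∃+⇒≤ (d * d) (square-nonneg d)
    (trans (+-congʳ (+-cong (+-cong xy xy) (+-cong xy xy)))
      (trans (solve 2 (λ x d → let y = x :+ d; p = x :* y in
                ((p :+ p) :+ (p :+ p)) :+ d :* d := (x :+ y) :* (x :+ y)) refl x d)
        (*-cong (+-congˡ x+d≈y) (+-congˡ x+d≈y))))
    where
    xy : x * y ≈ x * (x + d)
    xy = *-congˡ (sym x+d≈y)
  4xy≤[x+y]² x y | inj₂ y≤x with ≤⇒∃+ y≤x
  ...   | d , _ , y+d≈x = ∃+⇒≤ (d * d) (square-nonneg d)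
    (trans (+-congʳ (+-cong (+-cong xy xy) (+-cong xy xy)))
      (trans (solve 2 (λ y d → let x = y :+ d; p = x :* y in
                ((p :+ p) :+ (p :+ p)) :+ d :* d := (x :+ y) :* (x :+ y)) refl y d)
        (*-cong (+-congʳ y+d≈x) (+-congʳ y+d≈x))))
    where
    xy : x * y ≈ (y + d) * y
    xy = *-congʳ (sym y+d≈x)

  module _ (a : Carrier) (0≤a : 0# ≤ a) where

    private
      Below : Pred Carrier 0ℓ
      Below x = x * x ≤ a

      0∈Below : 0# ∈ Below
      0∈Below = ≤-respˡ (sym (zeroˡ 0#)) 0≤a

      0≤1+a : 0# ≤ 1# + a
      0≤1+a = +-nonneg 0≤1 0≤a

      a≤[1+a]² : a ≤ (1# + a) * (1# + a)
      a≤[1+a]² = ≤-respˡ (*-identityˡ a) (∃+⇒≤ (1# * 1# + (1# * a + a * a))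
        (+-nonneg (square-nonneg 1#) (+-nonneg (*-nonneg 0≤1 0≤a) (square-nonneg a)))
        (solve 2 (λ e a → e :* a :+ (e :* e :+ (e :* a :+ a :* a))
                     := (e :+ a) :* (e :+ a)) refl 1# a))

      1+a≉0 : ¬ 1# + a ≈ 0#
      1+a≉0 eq = 1≉0 (≤.antisym (∃+⇒≤ a 0≤a eq) 0≤1)

      bounded : Satisfiable (IsUpperBound Below)
      bounded = 1# + a , λ x x²≤a → square-cancel-≤ 0≤1+a (≤.trans x²≤a a≤[1+a]²)

      module _ (s : Carrier) (upper : IsUpperBound Below s)
               (least : ∀ b → IsUpperBound Below b → s ≤ b) where

        0≤s : 0# ≤ s
        0≤s = upper 0# 0∈Below

        -- If s ≠ 0, the Newton iterate z = (s² + a) / 2s bounds Below, so s ≤ z.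
        s²≤a : s * s ≤ a
        s²≤a with s ≤.≟ 0#
        ... | yes s≈0 = ≤-respˡ (sym (trans (*-congʳ s≈0) (zeroˡ s))) 0≤a
        ... | no  s≉0 with inverse (s + s) (s≉0 ∘ x+x≈0⇒x≈0 0≤s)
        ...   | i , 2si≈1 =
          +-cancelʳ-≤ (s * s) (≤-respʳ (+-comm (s * s) a) (≤-respʳ 2sz≈c
            (≤-respˡ (solve 1 (λ s → (s :+ s) :* s := s :* s :+ s :* s) refl s)
              (*-monoʳ-≤ (+-nonneg 0≤s 0≤s) (least z bounds)))))
          where
          c z : Carrier
          c = s * s + a
          z = i * c

          2sz≈c : (s + s) * z ≈ c
          2sz≈c = trans (sym (*-assoc (s + s) i c))
                    (trans (*-congʳ 2si≈1) (*-identityˡ c))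

          0≤z : 0# ≤ z
          0≤z = *-nonneg (inverse-nonneg (+-nonneg 0≤s 0≤s) 2si≈1)
                  (+-nonneg (square-nonneg s) 0≤a)

          a≤z² : a ≤ z * z
          a≤z² = ≤-respˡ
            (trans (solve 3 (λ s a i → let p = s :* s :* a in
                      (i :* i) :* ((p :+ p) :+ (p :+ p))
                        := a :* (((s :+ s) :* i) :* ((s :+ s) :* i))) refl s a i)
              (trans (*-congˡ (trans (*-cong 2si≈1 2si≈1) (*-identityˡ 1#)))
                (*-identityʳ a)))
            (≤-respʳ (solve 2 (λ i c → (i :* i) :* (c :* c)
                        := (i :* c) :* (i :* c)) refl i c)
              (*-monoʳ-≤ (square-nonneg i) (4xy≤[x+y]² (s * s) a)))

          bounds : IsUpperBound Below z
          bounds x x²≤a = square-cancel-≤ 0≤z (≤.trans x²≤a a≤z²)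

        -- If s ≠ 0, the point y = 2as / (s² + a) lies in Below, so y ≤ s.
        -- If s = 0, the point a / (1 + a) does, so a = 0.
        a≤s² : a ≤ s * s
        a≤s² with s ≤.≟ 0#
        ... | yes s≈0 with inverse (1# + a) 1+a≉0
        ...   | i , [1+a]i≈1 = ≤.trans
          (≤-respˡ (*-identityʳ a) (≤-respˡ (*-congˡ [1+a]i≈1)
            (≤-respˡ (solve 3 (λ a i c → c :* (a :* i) := a :* (c :* i)) refl a i (1# + a))
              (≤-respʳ (zeroʳ (1# + a))
                (*-monoʳ-≤ 0≤1+a (≤-respʳ s≈0 (upper (a * i) y∈Below)))))))
          (square-nonneg s)
          where
          y∈Below : a * i ∈ Below
          y∈Below = ≤-respʳ
            (trans (solve 3 (λ a i c → (a :* (i :* i)) :* (c :* c)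
                      := a :* ((c :* i) :* (c :* i))) refl a i (1# + a))
              (trans (*-congˡ (trans (*-cong [1+a]i≈1 [1+a]i≈1) (*-identityˡ 1#)))
                (*-identityʳ a)))
            (≤-respˡ (solve 2 (λ a i → (a :* (i :* i)) :* a := (a :* i) :* (a :* i)) refl a i)
              (*-monoʳ-≤ (*-nonneg 0≤a (square-nonneg i)) a≤[1+a]²))
        a≤s² | no s≉0 with inverse (s * s + a) c≉0
          where
          c≉0 : ¬ s * s + a ≈ 0#
          c≉0 c≈0 = s≉0 (square≤0⇒≈0 (∃+⇒≤ a 0≤a c≈0))
        ...   | i , ci≈1 = *-cancelˡ-≤ 0≤s s≉0 (+-cancelʳ-≤ (s * a)
          (≤-respˡ (trans (solve 4 (λ s a i c →
                        c :* (((s :* a) :+ (s :* a)) :* i)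
                          := (c :* i) :* ((s :* a) :+ (s :* a))) refl s a i c)
                      (trans (*-congʳ ci≈1) (*-identityˡ _)))
            (≤-respʳ (solve 2 (λ s a → (s :* s :+ a) :* s
                          := s :* (s :* s) :+ s :* a) refl s a)
              (*-monoʳ-≤ 0≤c (upper y y∈Below)))))
          where
          c y : Carrier
          c = s * s + a
          y = (s * a + s * a) * i

          0≤c : 0# ≤ c
          0≤c = +-nonneg (square-nonneg s) 0≤a

          y∈Below : y ∈ Below
          y∈Below = ≤-respʳ
            (trans (solve 3 (λ a i c → (a :* (i :* i)) :* (c :* c)
                      := a :* ((c :* i) :* (c :* i))) refl a i c)
              (trans (*-congˡ (trans (*-cong ci≈1 ci≈1) (*-identityˡ 1#)))
                (*-identityʳ a)))
            (≤-respˡ (solve 3 (λ s a i → let p = s :* s :* a; q = (s :* a :+ s :* a) :* i in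
                        (a :* (i :* i)) :* ((p :+ p) :+ (p :+ p)) := q :* q) refl s a i)
              (*-monoʳ-≤ (*-nonneg 0≤a (square-nonneg i)) (4xy≤[x+y]² (s * s) a)))

    abstract
      squareRoot : ∃ λ r → 0# ≤ r × r * r ≈ a
      squareRoot with supremum Below (0# , 0∈Below) bounded
      ... | s , upper , least = s , 0≤s s upper least ,
        ≤.antisym (s²≤a s upper least) (a≤s² s upper least)

module Euclidean (ℝ : CompleteOrderedField) where

  open CompleteOrderedField ℝ
  open RealProperties ℝ

  infix  8 _·_
  infixl 7 _⨯_
  infixr 7 _•_
  infixl 6 _⊕_ _⊖_
  infix  4 _≋_

  ℝ³ : Set
  ℝ³ = Vector Carrier 3

  _≋_ : Rel ℝ³ 0ℓ
  _≋_ = Pointwise _≈_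

  _⊕_ _⊖_ : ℝ³ → ℝ³ → ℝ³
  u ⊕ v = zipWith _+_ u v
  u ⊖ v = zipWith _-_ u v

  _•_ : Carrier → ℝ³ → ℝ³
  t • v = map (t *_) v

  _·_ : ℝ³ → ℝ³ → Carrier
  u · v = u 0F * v 0F + u 1F * v 1F + u 2F * v 2F

  _⨯_ : ℝ³ → ℝ³ → ℝ³
  u ⨯ v = (u 1F * v 2F - u 2F * v 1F)
        ∷ (u 2F * v 0F - u 0F * v 2F)
        ∷ (u 0F * v 1F - u 1F * v 0F)
        ∷ []

  0≤v·v : ∀ v → 0# ≤ v · v
  0≤v·v v = +-nonneg (+-nonneg (square-nonneg (v 0F)) (square-nonneg (v 1F)))
                     (square-nonneg (v 2F))

  ∥_∥ : ℝ³ → Carrier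
  ∥ v ∥ = proj₁ (squareRoot (v · v) (0≤v·v v))

  0≤∥_∥ : ∀ v → 0# ≤ ∥ v ∥
  0≤∥ v ∥ = proj₁ (proj₂ (squareRoot (v · v) (0≤v·v v)))

  _² : Carrier → Carrier
  x ² = x * x

  infix 9 _²

  Distances : Pred ℝ³ 0ℓ → Pred ℝ³ 0ℓ → Pred Carrier 0ℓ
  Distances A B r = ∃ λ p → ∃ λ q → p ∈ A × q ∈ B × r ≈ ∥ p ⊖ q ∥

  -- The Euclidean distance inf { ∥p - q∥ : p ∈ A, q ∈ B }.
  dist : (A B : Pred ℝ³ 0ℓ) → Satisfiable A → Satisfiable B → Carrier
  dist A B (p , p∈A) (q , q∈B) = proj₁ (infimum (Distances A B)
    (∥ p ⊖ q ∥ , p , q , p∈A , q∈B , refl)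
    (0# , λ _ (p , q , _ , _ , r≈) → ≤-respʳ (sym r≈) 0≤∥ p ⊖ q ∥))

  line : ℝ³ → ℝ³ → Pred ℝ³ 0ℓ
  line a d p = ∃ λ t → p ≋ a ⊕ t • d

  line-satisfiable : ∀ a d → Satisfiable (line a d)
  line-satisfiable a d = a ⊕ 0# • d , 0# , λ _ → refl

  Matrix : Set
  Matrix = Fin 3 → ℝ³   -- indexed by rows

  column : Matrix → Fin 3 → ℝ³
  column M j i = M i j

  δ : Fin 3 → Fin 3 → Carrier
  δ i j = if ⌊ i ≟ j ⌋ then 1# else 0#

  -- Triple product of the rows.
  det : Matrix → Carrier
  det M = M 0F · (M 1F ⨯ M 2F)

  -- The rotations about the origin are the linear maps given by matrices
  -- with MᵀM = I and det M = 1.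
  record SO3 : Set where
    field
      matrix     : Matrix
      orthogonal : ∀ i j → column matrix i · column matrix j ≈ δ i j
      det≈1      : det matrix ≈ 1#

  infixr 8 _▹_

  _▹_ : SO3 → ℝ³ → ℝ³
  (g ▹ v) i = SO3.matrix g i · v

module SafeZone (ℝ : CompleteOrderedField) where

  open CompleteOrderedField ℝ
  open Euclidean ℝ public

  2# 4# : Carrier
  2# = 1# + 1#
  4# = 2# + 2#

  u₀ v₀ : ℝ³
  u₀ = 0# ∷ 0# ∷ 1# ∷ []
  v₀ = 1# ∷ 0# ∷ 0# ∷ []

  ℓ₀ : Pred ℝ³ 0ℓ
  ℓ₀ = line (2# • u₀) v₀

  _▹ℓ₀ : SO3 → Pred ℝ³ 0ℓ
  g ▹ℓ₀ = line (2# • (g ▹ u₀)) (g ▹ v₀)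

  𝒟 : Pred SO3 0ℓ
  𝒟 g = 2# ≤ dist ℓ₀ (g ▹ℓ₀)
                  (line-satisfiable (2# • u₀) v₀)
                  (line-satisfiable (2# • (g ▹ u₀)) (g ▹ v₀))

  module _ (g : SO3) where

    a₁ a₂ d₁ d₂ w n : ℝ³
    a₁ = 2# • u₀
    a₂ = 2# • (g ▹ u₀)
    d₁ = v₀
    d₂ = g ▹ v₀
    w  = a₂ ⊖ a₁
    n  = d₁ ⨯ d₂

    N₂ : Carrier
    N₂ = ∥ n ∥ ²

    Γ : ℝ³ → Carrier
    Γ x = (x · d₁) ² - 2# * (x · d₁) * (x · d₂) * (d₁ · d₂) + (x · d₂) ²

    U₁² : Carrier
    U₁² = ∥ w ∥ ² - (w · d₁) ²

    Q : Carrier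
    Q = (∥ w ∥ ² - 4#) * N₂ - Γ w

-- With w, p = w·d₁, q = w·d₂, c = d₁·d₂ and unit directions, the squared distance
-- between a₁ + s d₁ and a₂ + t d₂ is (s - p - tc)² + U₁² + 2t(q - pc) + t²N₂.  The
-- first term vanishes for a suitable s, so the lines are at distance at least 2
-- exactly when the quadratic (U₁² - 4) + 2t(q - pc) + t²N₂ is nonnegative for all t.
-- As N₂ ≥ 0, this says that U₁² ≥ 4 and that (U₁² - 4)N₂ - (q - pc)² ≥ 0, and
-- N₂ = 1 - c² turns the latter expression into Q.  Parallel lines need no exception:
-- if N₂ = 0, either side forces q = pc.

module Submission where

open import Defs
open import Relation.Unary using (_≐_; _∩_)

open import Level using (Level)
open import Algebra.Bundles using (CommutativeRing)
open import Algebra.Solver.Ring.AlmostCommutativeRing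
  using (_-Raw-AlmostCommutative⟶_; fromCommutativeRing)
open import Data.Fin.Patterns using (0F; 1F; 2F)
open import Data.Integer.Base as ℤ using (ℤ; +_; -[1+_])
import Data.Integer.Properties as ℤₚ
open import Data.Maybe.Base using (Maybe; map)
open import Data.Nat.Base as ℕ using (zero; suc)
open import Data.Product.Base using (_×_; _,_; proj₁; proj₂)
open import Function.Bundles using (_⇔_; mk⇔; Equivalence)
open import Function.Construct.Composition using (_⇔-∘_)
open import Relation.Binary.Consequences using (dec⇒weaklyDec)
import Relation.Binary.PropositionalEquality.Core as ≡
import Relation.Binary.Reasoning.Setoid as SetoidReasoning
open import Relation.Nullary using (yes; no; contradiction)

-- Polynomial identities in commutative rings.

-- The semiring solver of the library has no subtraction, and over an abstract
-- ring the ring solver cannot decide when a coefficient vanishes; taking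
-- integer coefficients cures both.
module IntegerCoefficients {c ℓ : Level} (R : CommutativeRing c ℓ) where

  open CommutativeRing R
  open import Algebra.Properties.Ring ring
    using (-‿distribˡ-*; -‿distribʳ-*; -‿involutive; -0#≈0#)
  open import Algebra.Properties.AbelianGroup +-abelianGroup using (⁻¹-∙-comm)
  open import Algebra.Properties.CommutativeSemigroup +-commutativeSemigroup
    using (xy∙z≈xz∙y)
  open import Algebra.Properties.Semiring.Mult.TCOptimised semiring
    using (×-homo-+; ×1-homo-*; 1+×) renaming (_×_ to _×′_)
  open SetoidReasoning setoid

  -- With the optimised multiple, `fromℤ (+ 1)` reduces to `1#` itself, so `con (+ 1)` can stand for
  -- `1#` in the solver.
  fromℤ : ℤ → Carrier
  fromℤ (+ n)    = n ×′ 1#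
  fromℤ -[1+ n ] = - (suc n ×′ 1#)

  fromℤ-homo-neg : ∀ i → fromℤ (ℤ.- i) ≈ - fromℤ i
  fromℤ-homo-neg (+ zero)  = sym -0#≈0#
  fromℤ-homo-neg (+ suc n) = refl
  fromℤ-homo-neg -[1+ n ]  = sym (-‿involutive _)

  fromℤ-⊖ : ∀ m n → fromℤ (m ℤ.⊖ n) ≈ m ×′ 1# - n ×′ 1#
  fromℤ-⊖ m       zero    = sym (trans (+-congˡ -0#≈0#) (+-identityʳ _))
  fromℤ-⊖ zero    (suc n) = sym (+-identityˡ _)
  fromℤ-⊖ (suc m) (suc n) = begin
    fromℤ (suc m ℤ.⊖ suc n)         ≡⟨ ≡.cong fromℤ (ℤₚ.[1+m]⊖[1+n]≡m⊖n m n) ⟩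
    fromℤ (m ℤ.⊖ n)                 ≈⟨ fromℤ-⊖ m n ⟩
    -- A zero is inserted as `1# - 1#`, so that both multiples go up by one.
    m ×′ 1# - n ×′ 1#               ≈⟨ +-congʳ (+-identityˡ _) ⟨
    0# + m ×′ 1# - n ×′ 1#          ≈⟨ +-congʳ (+-congʳ (-‿inverseʳ 1#)) ⟨
    1# - 1# + m ×′ 1# - n ×′ 1#     ≈⟨ +-congʳ (xy∙z≈xz∙y 1# (- 1#) _) ⟩
    1# + m ×′ 1# - 1# - n ×′ 1#     ≈⟨ +-assoc _ _ _ ⟩
    1# + m ×′ 1# + (- 1# - n ×′ 1#) ≈⟨ +-congˡ (⁻¹-∙-comm 1# (n ×′ 1#)) ⟩
    1# + m ×′ 1# - (1# + n ×′ 1#)   ≈⟨ +-cong (1+× m 1#) (-‿cong (1+× n 1#)) ⟨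
    suc m ×′ 1# - suc n ×′ 1#       ∎

  fromℤ-homo-+ : ∀ i j → fromℤ (i ℤ.+ j) ≈ fromℤ i + fromℤ j
  fromℤ-homo-+ (+ m)    (+ n)    = ×-homo-+ 1# m n
  fromℤ-homo-+ (+ m)    -[1+ n ] = fromℤ-⊖ m (suc n)
  fromℤ-homo-+ -[1+ m ] (+ n)    = trans (fromℤ-⊖ n (suc m)) (+-comm _ _)
  fromℤ-homo-+ -[1+ m ] -[1+ n ] = begin
    fromℤ -[1+ suc (m ℕ.+ n) ]        ≡⟨ ≡.cong fromℤ (ℤₚ.neg-distrib-+ (+ suc m) (+ suc n)) ⟨
    fromℤ (ℤ.- (+ suc m ℤ.+ + suc n)) ≈⟨ fromℤ-homo-neg (+ suc m ℤ.+ + suc n) ⟩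
    - ((suc m ℕ.+ suc n) ×′ 1#)       ≈⟨ -‿cong (×-homo-+ 1# (suc m) (suc n)) ⟩
    - (suc m ×′ 1# + suc n ×′ 1#)     ≈⟨ ⁻¹-∙-comm _ _ ⟨
    fromℤ -[1+ m ] + fromℤ -[1+ n ]   ∎

  fromℤ-homo-*⁺⁺ : ∀ m n → fromℤ (+ m ℤ.* + n) ≈ fromℤ (+ m) * fromℤ (+ n)
  fromℤ-homo-*⁺⁺ m n = trans (reflexive (≡.cong fromℤ (≡.sym (ℤₚ.pos-* m n)))) (×1-homo-* m n)

  fromℤ-homo-*⁺ : ∀ m j → fromℤ (+ m ℤ.* j) ≈ fromℤ (+ m) * fromℤ j
  fromℤ-homo-*⁺ m (+ n)    = fromℤ-homo-*⁺⁺ m n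
  fromℤ-homo-*⁺ m -[1+ n ] = begin
    fromℤ (+ m ℤ.* -[1+ n ])          ≡⟨ ≡.cong fromℤ (ℤₚ.neg-distribʳ-* (+ m) (+ suc n)) ⟨
    fromℤ (ℤ.- (+ m ℤ.* + suc n))     ≈⟨ fromℤ-homo-neg (+ m ℤ.* + suc n) ⟩
    - fromℤ (+ m ℤ.* + suc n)         ≈⟨ -‿cong (fromℤ-homo-*⁺⁺ m (suc n)) ⟩
    - (fromℤ (+ m) * fromℤ (+ suc n)) ≈⟨ -‿distribʳ-* _ _ ⟩
    fromℤ (+ m) * fromℤ -[1+ n ]      ∎

  fromℤ-homo-* : ∀ i j → fromℤ (i ℤ.* j) ≈ fromℤ i * fromℤ j
  fromℤ-homo-* (+ m)    j = fromℤ-homo-*⁺ m j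
  fromℤ-homo-* -[1+ m ] j = begin
    fromℤ (-[1+ m ] ℤ.* j)        ≡⟨ ≡.cong fromℤ (ℤₚ.neg-distribˡ-* (+ suc m) j) ⟨
    fromℤ (ℤ.- (+ suc m ℤ.* j))   ≈⟨ fromℤ-homo-neg (+ suc m ℤ.* j) ⟩
    - fromℤ (+ suc m ℤ.* j)       ≈⟨ -‿cong (fromℤ-homo-*⁺ (suc m) j) ⟩
    - (fromℤ (+ suc m) * fromℤ j) ≈⟨ -‿distribˡ-* _ _ ⟩
    fromℤ -[1+ m ] * fromℤ j      ∎

  homomorphism : ℤ.+-*-rawRing -Raw-AlmostCommutative⟶ fromCommutativeRing R
  homomorphism = record
    { ⟦_⟧    = fromℤ
    ; +-homo = fromℤ-homo-+
    ; *-homo = fromℤ-homo-*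
    ; -‿homo = fromℤ-homo-neg
    ; 0-homo = refl
    ; 1-homo = refl
    }

  -- Only a positive answer is possible: distinct integers may have equal images in `R`.
  weaklyDecide : ∀ i j → Maybe (fromℤ i ≈ fromℤ j)
  weaklyDecide i j = map (λ i≡j → reflexive (≡.cong fromℤ i≡j)) (dec⇒weaklyDec ℤₚ._≟_ i j)

  open import Algebra.Solver.Ring _ _ homomorphism weaklyDecide public
    using (solve; con; _:=_; _:+_; _:-_; _:*_; :-_)

-- Quadratics that are nonnegative everywhere.

module RealQuadratic (ℝ : CompleteOrderedField) where

  open CompleteOrderedField ℝ
  open RealProperties ℝ
  open IntegerCoefficients commutativeRing

  x≤y⇒0≤y-x : ∀ {x y} → x ≤ y → 0# ≤ y - x
  x≤y⇒0≤y-x {x} x≤y = ≤-respˡ (-‿inverseʳ x) (+-monoˡ-≤ (- x) x≤y)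

  -- The solver takes no hypotheses. An equation `x ≈ y` therefore enters a polynomial identity as a
  -- multiple of `x - y`, which is removed afterwards.
  *-difference≈0 : ∀ {x y} z → x ≈ y → z * (x - y) ≈ 0#
  *-difference≈0 {y = y} z x≈y =
    trans (*-congˡ (trans (+-congʳ x≈y) (-‿inverseʳ y))) (zeroʳ z)

  0≤y-x⇒x≤y : ∀ {x y} → 0# ≤ y - x → x ≤ y
  0≤y-x⇒x≤y {x} {y} h = ∃+⇒≤ (y - x) h (solve 2 (λ x y → x :+ (y :- x) := y) refl x y)

  module _ (a b k : Carrier) where

    quadratic : Carrier → Carrier
    quadratic t = a + (t * b + t * b) + t * t * k

    -- Minus a quarter of the usual discriminant of a + 2bt + kt², hence nonnegative when the
    -- quadratic never changes sign.
    discriminant : Carrier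
    discriminant = a * k - b * b

    -- Multiplying by `k`, rather than dividing by it, keeps the identity valid at `k ≈ 0#`.
    complete-square : ∀ t →
      k * quadratic t ≈ discriminant + (b + t * k) * (b + t * k)
    complete-square t = solve 4 (λ a b k t →
      k :* (a :+ (t :* b :+ t :* b) :+ t :* t :* k)
        := (a :* k :- b :* b) :+ (b :+ t :* k) :* (b :+ t :* k)) refl a b k t

    linear : k ≈ 0# → ∀ t → quadratic t ≈ a + (t * b + t * b)
    linear k≈0 t = trans (+-congˡ (trans (*-congˡ k≈0) (zeroʳ _))) (+-identityʳ _)

    nonneg-coefficient : (∀ t → 0# ≤ quadratic t) → 0# ≤ a
    nonneg-coefficient h = ≤-respʳ
      (solve 3 (λ a b k → let o = con (+ 0) in
        a :+ (o :* b :+ o :* b) :+ o :* o :* k := a) refl a b k) (h 0#)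

    nonneg-discriminant : 0# ≤ k → (∀ t → 0# ≤ quadratic t) → 0# ≤ discriminant
    nonneg-discriminant 0≤k h with k ≤.≟ 0#
    ... | no k≉0 with inverse k k≉0
    ...   | i , ki≈1 = ≤-respʳ
      (trans (complete-square t) (trans (+-congˡ (trans (*-congʳ vertex) (zeroˡ _)))
        (+-identityʳ _)))
      (*-nonneg 0≤k (h t))
      where
      -- The vertex -b/k, where the completed square vanishes.
      t : Carrier
      t = - (b * i)

      vertex : b + t * k ≈ 0#
      vertex = trans
        (solve 3 (λ b k i → b :+ :- (b :* i) :* k := b :- b :* (k :* i)) refl b k i)
        (trans (+-congˡ (-‿cong (trans (*-congˡ ki≈1) (*-identityʳ b)))) (-‿inverseʳ b))
    nonneg-discriminant 0≤k h | yes k≈0 with b ≤.≟ 0#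
    ... | yes b≈0 = ≤.reflexive (sym (trans
      (+-cong (trans (*-congˡ k≈0) (zeroʳ a)) (-‿cong (trans (*-congˡ b≈0) (zeroʳ b))))
      (-‿inverseʳ 0#)))
    ... | no b≉0 with inverse b b≉0
    ...   | i , bi≈1 = contradiction (≤.antisym 1≤0 0≤1) 1≉0
      where
      -- For k = 0 and b ≠ 0 this choice gives a + 2bt = -(a + 2), which is negative because a ≥ 0.
      t : Carrier
      t = - ((a + 1#) * i)

      tb≈ : t * b ≈ - (a + 1#)
      tb≈ = trans
        (solve 3 (λ a b i → :- ((a :+ con (+ 1)) :* i) :* b
                    := :- ((a :+ con (+ 1)) :* (b :* i))) refl a b i)
        (-‿cong (trans (*-congˡ bi≈1) (*-identityʳ _)))

      1≤0 : 1# ≤ 0#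
      1≤0 = ≤.trans (∃+⇒≤ (a + 1#) (+-nonneg (nonneg-coefficient h) 0≤1) refl)
        (0≤y-x⇒x≤y (≤-respʳ
          (trans (linear k≈0 t) (trans (+-congˡ (+-cong tb≈ tb≈))
            (solve 1 (λ a → let e = con (+ 1); m = :- (a :+ e) in
               a :+ (m :+ m) := con (+ 0) :- (e :+ (a :+ e))) refl a)))
          (h t)))

    -- For k > 0 the completed square can be divided by `k`. For k = 0 the discriminant is -b², so b
    -- = 0 and the quadratic is the constant `a`.
    nonneg-quadratic : 0# ≤ k → 0# ≤ discriminant → 0# ≤ a → ∀ t → 0# ≤ quadratic t
    nonneg-quadratic 0≤k 0≤disc 0≤a t with k ≤.≟ 0#
    ... | no k≉0 = *-cancelˡ-≤ 0≤k k≉0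
      (≤-respˡ (sym (zeroʳ k)) (≤-respʳ (sym (complete-square t))
        (+-nonneg 0≤disc (square-nonneg (b + t * k)))))
    ... | yes k≈0 = ≤-respʳ (sym (trans (linear k≈0 t) (trans
        (+-congˡ (trans (+-cong tb≈0 tb≈0) (+-identityʳ 0#))) (+-identityʳ a)))) 0≤a
      where
      b≈0 : b ≈ 0#
      b≈0 = square≤0⇒≈0 (≤-respʳ (trans (*-congˡ k≈0) (zeroʳ a)) (0≤y-x⇒x≤y 0≤disc))

      tb≈0 : t * b ≈ 0#
      tb≈0 = trans (*-congˡ b≈0) (zeroʳ t)

-- Distance between two lines in space.

module Lines (ℝ : CompleteOrderedField) where

  open CompleteOrderedField ℝ
  open RealProperties ℝ
  open RealQuadratic ℝ
  open Euclidean ℝ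
  open IntegerCoefficients commutativeRing

  ∥_∥²≈ : ∀ v → ∥ v ∥ ² ≈ v · v
  ∥ v ∥²≈ = proj₂ (proj₂ (squareRoot (v · v) (0≤v·v v)))

  dist-infimum : ∀ A B a b → IsInfimum (Distances A B) (dist A B a b)
  dist-infimum A B (p , p∈A) (q , q∈B) = proj₂ (infimum (Distances A B) _ _)

  ·-cong : ∀ {u u′ v v′} → u ≋ u′ → v ≋ v′ → u · v ≈ u′ · v′
  ·-cong u≋ v≋ = +-cong (+-cong (*-cong (u≋ 0F) (v≋ 0F)) (*-cong (u≋ 1F) (v≋ 1F)))
                        (*-cong (u≋ 2F) (v≋ 2F))

  lagrange : ∀ u v → (u ⨯ v) · (u ⨯ v) + (u · v) ² ≈ (u · u) * (v · v)
  lagrange u v = solve 6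
    (λ x y z x′ y′ z′ →
      let i = y :* z′ :- z :* y′
          j = z :* x′ :- x :* z′
          k = x :* y′ :- y :* x′
          uv = x :* x′ :+ y :* y′ :+ z :* z′ in
      i :* i :+ j :* j :+ k :* k :+ uv :* uv
        := (x :* x :+ y :* y :+ z :* z) :* (x′ :* x′ :+ y′ :* y′ :+ z′ :* z′))
    refl (u 0F) (u 1F) (u 2F) (v 0F) (v 1F) (v 2F)

  -- The difference of the two points is -(w - s d₁ + t d₂), which accounts for the signs.
  ∥line⊖line∥² : ∀ a₁ d₁ a₂ d₂ s t → let w = a₂ ⊖ a₁; v = (a₁ ⊕ s • d₁) ⊖ (a₂ ⊕ t • d₂) in
    v · v ≈ w · w + s * s * (d₁ · d₁) + t * t * (d₂ · d₂) + (t * (w · d₂) + t * (w · d₂))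
      - (s * (w · d₁) + s * (w · d₁)) - (s * t * (d₁ · d₂) + s * t * (d₁ · d₂))
  ∥line⊖line∥² a d b e s t = solve 14
    (λ a₀ a₁ a₂ d₀ d₁ d₂ b₀ b₁ b₂ e₀ e₁ e₂ s t →
      let dot = λ x y z x′ y′ z′ → x :* x′ :+ y :* y′ :+ z :* z′
          v₀ = (a₀ :+ s :* d₀) :- (b₀ :+ t :* e₀)
          v₁ = (a₁ :+ s :* d₁) :- (b₁ :+ t :* e₁)
          v₂ = (a₂ :+ s :* d₂) :- (b₂ :+ t :* e₂)
          w₀ = b₀ :- a₀
          w₁ = b₁ :- a₁
          w₂ = b₂ :- a₂
          q  = dot w₀ w₁ w₂ e₀ e₁ e₂
          p  = dot w₀ w₁ w₂ d₀ d₁ d₂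
          c  = dot d₀ d₁ d₂ e₀ e₁ e₂ in
      dot v₀ v₁ v₂ v₀ v₁ v₂
        := dot w₀ w₁ w₂ w₀ w₁ w₂ :+ s :* s :* dot d₀ d₁ d₂ d₀ d₁ d₂
           :+ t :* t :* dot e₀ e₁ e₂ e₀ e₁ e₂
           :+ (t :* q :+ t :* q) :- (s :* p :+ s :* p) :- (s :* t :* c :+ s :* t :* c))
    refl (a 0F) (a 1F) (a 2F) (d 0F) (d 1F) (d 2F)
    (b 0F) (b 1F) (b 2F) (e 0F) (e 1F) (e 2F) s t

  module _ (a₁ d₁ a₂ d₂ : ℝ³) where

    private
      w n : ℝ³
      w = a₂ ⊖ a₁
      n = d₁ ⨯ d₂

      W N p q c b : Carrier
      W = ∥ w ∥ ²
      N = ∥ n ∥ ²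
      p = w · d₁
      q = w · d₂
      c = d₁ · d₂
      b = q - p * c

      U : Carrier
      U = W - p ²

    between : Carrier → Carrier → ℝ³
    between s t = (a₁ ⊕ s • d₁) ⊖ (a₂ ⊕ t • d₂)

    -- A number is at most an infimum exactly when it bounds the set from below, and for nonnegative
    -- numbers the order can be tested on squares, which removes the root.
    ≤-dist⇔ : ∀ {r D} a b → 0# ≤ r → r ² ≈ D →
      r ≤ dist (line a₁ d₁) (line a₂ d₂) a b ⇔ (∀ s t → D ≤ between s t · between s t)
    ≤-dist⇔ {r} {D} a b 0≤r r²≈D = mk⇔ to from
      where
      inf = dist-infimum (line a₁ d₁) (line a₂ d₂) a b

      to : r ≤ dist (line a₁ d₁) (line a₂ d₂) a b → ∀ s t → D ≤ between s t · between s t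
      -- r² ≤ r∥v∥ ≤ ∥v∥² for v = `between s t`.
      to r≤dist s t = ≤-respˡ r²≈D (≤-respʳ ∥ between s t ∥²≈ (≤.trans (*-monoʳ-≤ 0≤r r≤)
        (≤-respˡ (*-comm _ _) (*-monoʳ-≤ 0≤∥ between s t ∥ r≤))))
        where
        r≤ : r ≤ ∥ between s t ∥
        r≤ = ≤.trans r≤dist (proj₁ inf _
          (a₁ ⊕ s • d₁ , a₂ ⊕ t • d₂ , (s , λ _ → refl) , (t , λ _ → refl) , refl))

      from : (∀ s t → D ≤ between s t · between s t) → r ≤ dist (line a₁ d₁) (line a₂ d₂) a b
      from h = proj₂ inf r λ { x (y , z , (s , y≋) , (t , z≋) , x≈) →
        let y⊖z≋ : y ⊖ z ≋ between s t
            y⊖z≋ i = +-cong (y≋ i) (-‿cong (z≋ i)) in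
        ≤-respʳ (sym x≈) (square-cancel-≤ 0≤∥ y ⊖ z ∥
          (≤-respˡ (sym r²≈D) (≤-respʳ (sym (trans ∥ y ⊖ z ∥²≈ (·-cong y⊖z≋ y⊖z≋))) (h s t)))) }

    module _ (d₁·d₁≈1 : d₁ · d₁ ≈ 1#) (d₂·d₂≈1 : d₂ · d₂ ≈ 1#) (D : Carrier) where

      -- Lagrange's identity for unit vectors: sin² + cos² = 1 for the angle between the directions.
      N+c²≈1 : N + c ² ≈ 1#
      N+c²≈1 = trans (+-congʳ ∥ n ∥²≈) (trans (lagrange d₁ d₂)
        (trans (*-cong d₁·d₁≈1 d₂·d₂≈1) (*-identityˡ 1#)))

      -- Completing the square in s: the foot of the perpendicular dropped from
      -- a₂ + t d₂ to the first line has parameter s = p + t c.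
      between²-D : ∀ s t →
        between s t · between s t - D ≈ quadratic (U - D) b N t + (s - (p + t * c)) ²
      between²-D s t = trans (+-congʳ (∥line⊖line∥² a₁ d₁ a₂ d₂ s t))
        (trans
          (solve 10
            (λ W D E E′ N p q c s t → let e = con (+ 1); b = q :- p :* c; x = s :- (p :+ t :* c) in
              W :+ s :* s :* E :+ t :* t :* E′ :+ (t :* q :+ t :* q) :- (s :* p :+ s :* p)
                  :- (s :* t :* c :+ s :* t :* c) :- D
                := (W :- p :* p :- D) :+ (t :* b :+ t :* b) :+ t :* t :* N :+ x :* x
                   -- Error terms that vanish for unit directions, as N + c² = 1.
                   :+ (s :* s :* (E :- e) :+ t :* t :* (E′ :- (N :+ c :* c))))
            refl (w · w) D (d₁ · d₁) (d₂ · d₂) N p q c s t)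
          (trans
            (+-cong (+-congʳ (+-congʳ (+-congʳ (+-congʳ (+-congʳ (sym ∥ w ∥²≈))))))
              (+-cong (*-difference≈0 (s * s) d₁·d₁≈1)
                (*-difference≈0 (t * t) (trans d₂·d₂≈1 (sym N+c²≈1)))))
            (trans (+-congˡ (+-identityʳ 0#)) (+-identityʳ _))))

      -- For the lines of the safe zone and D = 4 this unfolds to `Q`, just as `U` unfolds to `U₁²`.
      Q⟨D⟩ : Carrier
      Q⟨D⟩ = (W - D) * N - (p ² - (1# + 1#) * p * q * c + q ²)

      Q⟨D⟩≈discriminant : Q⟨D⟩ ≈ discriminant (U - D) b N
      Q⟨D⟩≈discriminant = trans
        (solve 6 (λ W D N p q c → let e = con (+ 1); b = q :- p :* c in
          (W :- D) :* N :- (p :* p :- (e :+ e) :* p :* q :* c :+ q :* q)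
            -- The p²N coming from `U` and the p²c² coming from b² together make the p² of `Q⟨D⟩`.
            := (W :- p :* p :- D) :* N :- b :* b :+ p :* p :* (N :+ c :* c :- e))
          refl W D N p q c)
        (trans (+-congˡ (*-difference≈0 (p ²) N+c²≈1)) (+-identityʳ _))

      ≤-between⇔ : (∀ s t → D ≤ between s t · between s t) ⇔ (0# ≤ Q⟨D⟩ × D ≤ U)
      ≤-between⇔ = mk⇔ to from
        where
        to : (∀ s t → D ≤ between s t · between s t) → 0# ≤ Q⟨D⟩ × D ≤ U
        to h =
          ≤-respʳ (sym Q⟨D⟩≈discriminant) (nonneg-discriminant (U - D) b N
            (square-nonneg ∥ n ∥) nonneg) ,
          0≤y-x⇒x≤y (nonneg-coefficient (U - D) b N nonneg)
          where
          -- At the foot of the perpendicular the square in `s` vanishes and the quadratic alone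
          -- remains.
          nonneg : ∀ t → 0# ≤ quadratic (U - D) b N t
          nonneg t = ≤-respʳ
            (trans (between²-D foot t)
              (trans (+-congˡ (*-difference≈0 (foot - foot) refl)) (+-identityʳ _)))
            (x≤y⇒0≤y-x (h foot t))
            where
            foot : Carrier
            foot = p + t * c

        from : 0# ≤ Q⟨D⟩ × D ≤ U → ∀ s t → D ≤ between s t · between s t
        from (0≤Q⟨D⟩ , D≤U) s t = 0≤y-x⇒x≤y (≤-respʳ (sym (between²-D s t))
          (+-nonneg (nonneg-quadratic (U - D) b N (square-nonneg ∥ n ∥)
              (≤-respʳ Q⟨D⟩≈discriminant 0≤Q⟨D⟩) (x≤y⇒0≤y-x D≤U) t)
            (square-nonneg (s - (p + t * c)))))

-- Application to the safe zone.

module _ (ℝ : CompleteOrderedField) where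

  open CompleteOrderedField ℝ
  open RealProperties ℝ
  open SafeZone ℝ
  open Lines ℝ
  open IntegerCoefficients commutativeRing

  v₀·v₀≈1 : v₀ · v₀ ≈ 1#
  v₀·v₀≈1 = solve 0 (let o = con (+ 0); e = con (+ 1) in
    e :* e :+ o :* o :+ o :* o := e) refl

  -- `v₀` is the first basis vector, so orthogonality of the columns makes `g ▹ v₀` a unit vector.
  ▹v₀≋column : ∀ g → g ▹ v₀ ≋ column (SO3.matrix g) 0F
  ▹v₀≋column g i = solve 3 (λ x y z → let o = con (+ 0) in
    x :* con (+ 1) :+ y :* o :+ z :* o := x) refl
    (SO3.matrix g i 0F) (SO3.matrix g i 1F) (SO3.matrix g i 2F)

  ▹v₀·▹v₀≈1 : ∀ g → (g ▹ v₀) · (g ▹ v₀) ≈ 1#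
  ▹v₀·▹v₀≈1 g = trans (·-cong (▹v₀≋column g) (▹v₀≋column g)) (SO3.orthogonal g 0F 0F)

  0≤2 : 0# ≤ 2#
  0≤2 = +-nonneg 0≤1 0≤1

  2²≈4 : 2# ² ≈ 4#
  2²≈4 = solve 0 (let e = con (+ 1) in
    (e :+ e) :* (e :+ e) := e :+ e :+ (e :+ e)) refl

  𝒟⇔ : ∀ g → 𝒟 g ⇔ (0# ≤ Q g × 4# ≤ U₁² g)
  𝒟⇔ g = ≤-between⇔ (a₁ g) (d₁ g) (a₂ g) (d₂ g) v₀·v₀≈1 (▹v₀·▹v₀≈1 g) 4#
    ⇔-∘ ≤-dist⇔ (a₁ g) (d₁ g) (a₂ g) (d₂ g) _ _ 0≤2 2²≈4

theorem5p5 : (ℝ : CompleteOrderedField) →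
    let open CompleteOrderedField ℝ in
    let open SafeZone ℝ in
    𝒟 ≐ ((λ g → 0# ≤ Q g) ∩ (λ g → 4# ≤ U₁² g))
theorem5p5 ℝ = (λ {g} → Equivalence.to (𝒟⇔ ℝ g)) , (λ {g} → Equivalence.from (𝒟⇔ ℝ g))
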